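{- Let $\Sigma_1=(G_1,\sigma_1)$ and $\Sigma_2=(G_2,\sigma_2)$ be two finite, simple, connected signed graphs, where $\Sigma_2$ is all-positive. Then the BCD-lexicographic product satisfies $\operatorname{bdim}(\Sigma_1*\Sigma_2)=\operatorname{bdim}(\Sigma_1)$.
   Context: A signed graph $\Sigma=(G,\sigma)$ is a graph $G=(V,E)$ with a function $\sigma:E\to\{+1,-1\}$; it is all-positive if every edge has sign $+1$. All graphs are finite, simple, connected and undirected unless otherwise mentioned. Let $\Omega=\{ -1,0,1\}$, with $\Omega^k\subset\mathbb{R}^k$ carrying the standard inner product $\langle\cdot,\cdot\rangle$. A vector valued switching function ($k$-switching function) for $\Sigma$ is a map $\zeta:V\to\Omega^k$ with $\langle\zeta(u),\zeta(v)\rangle\neq 0$ for every edge $uv\in E$; the switched signed graph $\Sigma^\zeta=(G,\sigma^\zeta)$ has $\sigma^\zeta(uv)=\sigma(uv)\operatorname{sgn}(\langle\zeta(u),\zeta(v)\rangle)$. The balancing dimension $\operatorname{bdim}(\Sigma)$ is the least integer $k\ge 1$ for which there is a $k$-switching function $\zeta:V\to\Omega^k$ such that $\Sigma^\zeta$ is all-positive. The lexicographic product of graphs $G_1,G_2$ has vertex set $V(G_1)\times V(G_2)$, with $(u_i,v_j)$ adjacent to $(u_k,v_l)$ iff $u_i\sim u_k$ in $G_1$, or $u_i=u_k$ and $v_j\sim v_l$ in $G_2$. The BCD-lexicographic product $\Sigma_1*\Sigma_2$ is the signed graph on this lexicographic product with signature $$\sigma((u_i,v_j)(u_k,v_l))=\begin{cases}\sigma_1(u_iu_k)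 & \text{if } u_i\sim u_k \text{ and } v_j\nsim v_l,\\ \sigma_1(u_iu_k)\sigma_2(v_jv_l) & \text{if } u_i\sim u_k\text{ and } v_j\sim v_l,\\ \sigma_2(v_jv_l) & \text{if } u_i=u_k \text{ and } v_j\sim v_l,\end{cases}$$ where $v_j\nsim v_l$ includes the case $v_j=v_l$. -}

module Defs where

open import Data.Fin using (Fin; zero; suc; combine; remQuot; finToFun; funToFin)
open import Data.Fin.Properties
  using (all?; any?; *↔×; remQuot-combine; finToFun-funToFin; inj⇒≟)
open import Data.Integer as ℤ using (ℤ; 0ℤ; 1ℤ; -1ℤ; sign; _◃_)
import Data.Integer.Properties as ℤₚ
open import Data.Nat as ℕ using (ℕ; zero; suc; _≤_; z≤n; s≤s; _^_)
import Data.Nat.Properties as ℕₚ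
open import Data.Product using (Σ; ∃; ∃-syntax; _×_; _,_; proj₁; proj₂)
open import Data.Product.Function.NonDependent.Propositional using (_×-↔_)
open import Data.Sign as Sign using (Sign)
import Data.Sign.Properties as Signₚ
open import Data.Sum using (_⊎_; inj₁; inj₂)
open import Data.Vec.Functional using (Vector)
open import Function using (_∘_; _↔_; Inverse)
open import Function.Construct.Composition using (_↔-∘_)
open import Function.Construct.Symmetry using (↔-sym)
open import Function.Properties.Inverse using (↔⇒↣)
open import Relation.Binary.Construct.Closure.ReflexiveTransitive using (Star)
open import Relation.Binary.Definitions using (Decidable; DecidableEquality)
open import Relation.Binary.PropositionalEquality
  using (_≡_; _≢_; refl; sym; trans; cong; cong₂; subst)
open import Relation.Nullary
  using (¬_; Dec; yes; no; contradiction; contradiction-irr)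
open import Relation.Nullary.Decidable using (_×-dec_; _⊎-dec_; ¬?; map′)

open import Algebra.Properties.Monoid.Sum ℤₚ.+-0-monoid using (sum; sum-cong-≗)

------------------------------------------------------------------------
-- Graphs

record Graph : Set₁ where
  infix 4 _~_ _~?_
  field
    V        : Set
    size     : ℕ
    finite   : V ↔ Fin size
    _~_      : V → V → Set
    _~?_     : Decidable _~_
    ~-sym    : ∀ {u v} → u ~ v → v ~ u
    ~-irrefl : ∀ {u} → ¬ (u ~ u)

  _≟_ : DecidableEquality V
  _≟_ = inj⇒≟ (↔⇒↣ finite)

-- A connected graph is in particular nonempty.

Connected : Graph → Set
Connected G = V × (∀ u v → Star _~_ u v)
  where open Graph G

-- The sign takes its adjacency proof irrelevantly, so that an edge, and not
-- a proof of adjacency, carries the sign.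

record SignedGraph : Set₁ where
  field
    graph : Graph
  open Graph graph public
  field
    σ     : ∀ {u v} → .(u ~ v) → Sign
    σ-sym : ∀ {u v} → .(e : u ~ v) → σ (~-sym e) ≡ σ e

AllPositive : SignedGraph → Set
AllPositive S = ∀ {u v} (e : u ~ v) → σ e ≡ Sign.+
  where open SignedGraph S

------------------------------------------------------------------------
-- Vector valued switching

data Ω : Set where
  -1Ω 0Ω 1Ω : Ω

toℤ : Ω → ℤ
toℤ -1Ω = -1ℤ
toℤ 0Ω  = 0ℤ
toℤ 1Ω  = 1ℤ

⟨_,_⟩ : ∀ {k} → Vector Ω k → Vector Ω k → ℤ
⟨ x , y ⟩ = sum (λ i → toℤ (x i) ℤ.* toℤ (y i))

⟨⟩-comm : ∀ {k} (x y : Vector Ω k) → ⟨ x , y ⟩ ≡ ⟨ y , x ⟩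
⟨⟩-comm x y = sum-cong-≗ (λ i → ℤₚ.*-comm (toℤ (x i)) (toℤ (y i)))

record SwitchingFunction (S : SignedGraph) (k : ℕ) : Set where
  open SignedGraph S
  field
    ζ       : V → Vector Ω k
    nonzero : ∀ {u v} → u ~ v → ⟨ ζ u , ζ v ⟩ ≢ 0ℤ

-- `sign` sends 0 to +, but it is only applied to nonzero inner products here.

switch : ∀ {k} (S : SignedGraph) → SwitchingFunction S k → SignedGraph
switch S Z = record
  { graph = graph
  ; σ     = λ {u} {v} e → σ e Sign.* sign ⟨ ζ u , ζ v ⟩
  ; σ-sym = λ {u} {v} e →
      cong₂ Sign._*_ (σ-sym e) (cong sign (⟨⟩-comm (ζ v) (ζ u)))
  }
  where
  open SignedGraph S
  open SwitchingFunction Z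

Balanceable : SignedGraph → ℕ → Set
Balanceable S k = Σ (SwitchingFunction S k) λ Z → AllPositive (switch S Z)

IsBdim : SignedGraph → ℕ → Set
IsBdim S k =
  1 ≤ k × Balanceable S k × (∀ j → 1 ≤ j → Balanceable S j → k ≤ j)

------------------------------------------------------------------------
-- The balancing dimension exists

-- `Balanceable S k` is decided by enumerating the maps V → Ω^k.

module _ (S : SignedGraph) where
  open SignedGraph S

  private
    toF : V → Fin size
    toF = Inverse.to finite

    fromF : Fin size → V
    fromF = Inverse.from finite

    fromF-toF : ∀ v → fromF (toF v) ≡ v
    fromF-toF = Inverse.strictlyInverseʳ finite

    allV? : {P : V → Set} → (∀ v → Dec (P v)) → Dec (∀ v → P v)
    allV? {P} P? = map′ (λ f v → subst P (fromF-toF v) (f (toF v)))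
                        (λ f i → f (fromF i))
                        (all? (λ i → P? (fromF i)))

    Good : ∀ {k} → (V → Vector Ω k) → Set
    Good z = ∀ u v → (e : u ~ v) →
      ⟨ z u , z v ⟩ ≢ 0ℤ × σ e Sign.* sign ⟨ z u , z v ⟩ ≡ Sign.+

    Good? : ∀ {k} (z : V → Vector Ω k) → Dec (Good z)
    Good? z = allV? λ u → allV? λ v → edge? u v
      where
      edge? : ∀ u v → Dec ((e : u ~ v) →
        ⟨ z u , z v ⟩ ≢ 0ℤ × σ e Sign.* sign ⟨ z u , z v ⟩ ≡ Sign.+)
      edge? u v with u ~? v
      ... | no ¬e = yes λ e → contradiction e ¬e
      ... | yes e = map′ (λ p _ → p) (λ f → f e)
        (¬? (⟨ z u , z v ⟩ ℤ.≟ 0ℤ) ×-dec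
         ((σ e Sign.* sign ⟨ z u , z v ⟩) Signₚ.≟ Sign.+))

    Good-cong : ∀ {k} {z w : V → Vector Ω k} →
                (∀ v i → z v i ≡ w v i) → Good z → Good w
    Good-cong {z = z} {w} z≗w good u v e =
      subst (λ x → x ≢ 0ℤ × σ e Sign.* sign x ≡ Sign.+)
        (sum-cong-≗ (λ i → cong₂ (λ a b → toℤ a ℤ.* toℤ b) (z≗w u i) (z≗w v i)))
        (good u v e)

    toΩ : Fin 3 → Ω
    toΩ zero             = -1Ω
    toΩ (suc zero)       = 0Ω
    toΩ (suc (suc zero)) = 1Ω

    fromΩ : Ω → Fin 3
    fromΩ -1Ω = zero
    fromΩ 0Ω  = suc zero
    fromΩ 1Ω  = suc (suc zero)

    toΩ-fromΩ : ∀ x → toΩ (fromΩ x) ≡ x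
    toΩ-fromΩ -1Ω = refl
    toΩ-fromΩ 0Ω  = refl
    toΩ-fromΩ 1Ω  = refl

    decode : ∀ {k} → Fin ((3 ^ k) ^ size) → V → Vector Ω k
    decode {k} c v i = toΩ (finToFun {3} {k} (finToFun {3 ^ k} {size} c (toF v)) i)

    encode : ∀ {k} → (V → Vector Ω k) → Fin ((3 ^ k) ^ size)
    encode {k} z =
      funToFin {size} {3 ^ k} λ j → funToFin {k} {3} λ i → fromΩ (z (fromF j) i)

    decode-encode : ∀ {k} (z : V → Vector Ω k) v i → decode (encode z) v i ≡ z v i
    decode-encode {k} z v i
      rewrite finToFun-funToFin {size} {3 ^ k}
                (λ j → funToFin {k} {3} λ i → fromΩ (z (fromF j) i)) (toF v)
            | finToFun-funToFin {k} {3} (λ i → fromΩ (z (fromF (toF v)) i)) i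
            | fromF-toF v
            = toΩ-fromΩ (z v i)

    good⇒balanceable : ∀ {k} (z : V → Vector Ω k) → Good z → Balanceable S k
    good⇒balanceable z good =
      record { ζ = z ; nonzero = λ {u} {v} e → proj₁ (good u v e) } ,
      λ {u} {v} e → proj₂ (good u v e)

    balanceable⇒good : ∀ {k} → Balanceable S k → ∃[ z ] Good {k} z
    balanceable⇒good (Z , pos) =
      SwitchingFunction.ζ Z , λ u v e → SwitchingFunction.nonzero Z e , pos e

  balanceable? : ∀ k → Dec (Balanceable S k)
  balanceable? k = map′
    (λ (c , good) → good⇒balanceable (decode c) good)
    (λ b → let (z , good) = balanceable⇒good b in
      encode z , Good-cong (λ v i → sym (decode-encode z v i)) good)
    (any? (λ c → Good? (decode {k} c)))

  -- An all-positive switching always exists: use one coordinate for each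
  -- pair (a , b) with a ~ b, in which a has entry 1, b has entry σ(ab) and
  -- every other vertex has entry 0. The extra coordinate (constantly 0)
  -- ensures k ≥ 1.

  private
    signΩ : Sign → Ω
    signΩ Sign.- = -1Ω
    signΩ Sign.+ = 1Ω

    coord : V → V × V → Ω
    coord w (a , b) with a ~? b
    ... | no _  = 0Ω
    ... | yes e with w ≟ a
    ...   | yes _ = 1Ω
    ...   | no _ with w ≟ b
    ...     | yes _ = signΩ (σ e)
    ...     | no _  = 0Ω

    1*s : ∀ s → toℤ 1Ω ℤ.* toℤ (signΩ s) ≡ s ◃ 1
    1*s Sign.- = refl
    1*s Sign.+ = refl

    s*1 : ∀ s → toℤ (signΩ s) ℤ.* toℤ 1Ω ≡ s ◃ 1
    s*1 Sign.- = refl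
    s*1 Sign.+ = refl

    coord-mul : ∀ {u v} (e : u ~ v) p →
                ∃[ m ] toℤ (coord u p) ℤ.* toℤ (coord v p) ≡ σ e ◃ m
    coord-mul {u} {v} e (a , b) with a ~? b
    ... | no _ = 0 , refl
    ... | yes f with u ≟ a
    coord-mul {u} {v} e (a , b) | yes f | yes refl with v ≟ a
    ... | yes refl = contradiction e ~-irrefl
    ... | no _ with v ≟ b
    ...   | yes refl = 1 , 1*s (σ e)
    ...   | no _     = 0 , refl
    coord-mul {u} {v} e (a , b) | yes f | no _ with u ≟ b
    ... | no _ = 0 , refl
    ... | yes refl with v ≟ a
    ...   | yes refl = 1 , trans (s*1 (σ f)) (cong (_◃ 1) (σ-sym e))
    ...   | no _ with v ≟ b
    ...     | yes refl = contradiction e ~-irrefl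
    ...     | no _     = 0 , ℤₚ.*-zeroʳ (toℤ (signΩ (σ f)))

    coord-edge : ∀ {u v} (e : u ~ v) →
      toℤ (coord u (u , v)) ℤ.* toℤ (coord v (u , v)) ≡ σ e ◃ 1
    coord-edge {u} {v} e with u ~? v
    ... | no ¬e = contradiction e ¬e
    ... | yes f with u ≟ u
    ...   | no u≢u = contradiction refl u≢u
    ...   | yes _ with v ≟ u
    ...     | yes refl = contradiction e ~-irrefl
    ...     | no _ with v ≟ v
    ...       | yes _  = 1*s (σ e)
    ...       | no v≢v = contradiction refl v≢v

    sum-◃ : ∀ s {n} (t : Vector ℤ n) → (∀ i → ∃[ m ] t i ≡ s ◃ m) →
            ∃[ m ] sum t ≡ s ◃ m
    sum-◃ s {zero}  t h = 0 , refl
    sum-◃ s {suc n} t h =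
      let (m , p) = h zero ; (l , q) = sum-◃ s (t ∘ suc) (h ∘ suc)
      in m ℕ.+ l , trans (cong₂ ℤ._+_ p q) (sym (ℤₚ.◃-distrib-+ s m l))

    sum-◃⁺ : ∀ s {n} (t : Vector ℤ n) → (∀ i → ∃[ m ] t i ≡ s ◃ m) →
             ∀ i → t i ≡ s ◃ 1 → ∃[ m ] sum t ≡ s ◃ suc m
    sum-◃⁺ s t h zero p =
      let (l , q) = sum-◃ s (t ∘ suc) (h ∘ suc)
      in l , trans (cong₂ ℤ._+_ p q) (sym (ℤₚ.◃-distrib-+ s 1 l))
    sum-◃⁺ s t h (suc i) p =
      let (m , r) = h zero ; (l , q) = sum-◃⁺ s (t ∘ suc) (h ∘ suc) i p
      in m ℕ.+ l , trans (cong₂ ℤ._+_ r q)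
           (trans (sym (ℤₚ.◃-distrib-+ s m (suc l))) (cong (s ◃_) (ℕₚ.+-suc m l)))

    s◃suc-good : ∀ s m → s ◃ suc m ≢ 0ℤ × s Sign.* sign (s ◃ suc m) ≡ Sign.+
    s◃suc-good Sign.- m = (λ ()) , refl
    s◃suc-good Sign.+ m = (λ ()) , refl

    bound : ℕ
    bound = suc (size ℕ.* size)

    pair : Fin (size ℕ.* size) → V × V
    pair i = let (a , b) = remQuot size i in fromF a , fromF b

    canonical : V → Vector Ω bound
    canonical w zero    = 0Ω
    canonical w (suc i) = coord w (pair i)

    canonical-good : Good canonical
    canonical-good u v e =
      let (m , p) = sum-◃⁺ (σ e) _ terms (suc i₀) edge
      in subst (λ x → x ≢ 0ℤ × σ e Sign.* sign x ≡ Sign.+) (sym p) (s◃suc-good (σ e) m)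
      where
      terms : ∀ i →
        ∃[ m ] toℤ (canonical u i) ℤ.* toℤ (canonical v i) ≡ σ e ◃ m
      terms zero    = 0 , refl
      terms (suc i) = coord-mul e (pair i)

      i₀ : Fin (size ℕ.* size)
      i₀ = combine (toF u) (toF v)

      pair-i₀ : pair i₀ ≡ (u , v)
      pair-i₀ = trans
        (cong (λ (a , b) → fromF a , fromF b) (remQuot-combine (toF u) (toF v)))
        (cong₂ _,_ (fromF-toF u) (fromF-toF v))

      edge : toℤ (coord u (pair i₀)) ℤ.* toℤ (coord v (pair i₀)) ≡ σ e ◃ 1
      edge = subst (λ p → toℤ (coord u p) ℤ.* toℤ (coord v p) ≡ σ e ◃ 1)
                   (sym pair-i₀) (coord-edge e)

    -- Search upwards from j, which is reached with everything below it
    -- excluded; `fuel` steps lead to the known solution.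

    search : ∀ fuel j → 1 ≤ j → Balanceable S (fuel ℕ.+ j) →
             (∀ i → 1 ≤ i → Balanceable S i → j ≤ i) → ∃[ k ] IsBdim S k
    search zero j 1≤j b low = j , 1≤j , b , low
    search (suc fuel) j 1≤j b low with balanceable? j
    ... | yes bj = j , 1≤j , bj , low
    ... | no ¬bj = search fuel (suc j) (s≤s z≤n)
          (subst (Balanceable S) (sym (ℕₚ.+-suc fuel j)) b)
          λ i 1≤i bi → ℕₚ.≤∧≢⇒< (low i 1≤i bi) λ { refl → ¬bj bi }

  abstract
    bdim-exists : ∃[ k ] IsBdim S k
    bdim-exists = search (size ℕ.* size) 1 (s≤s z≤n)
      (subst (Balanceable S) (ℕₚ.+-comm 1 (size ℕ.* size))
        (good⇒balanceable canonical canonical-good))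
      (λ _ 1≤i _ → 1≤i)

bdim : SignedGraph → ℕ
bdim S = proj₁ (bdim-exists S)

bdim-isBdim : ∀ S → IsBdim S (bdim S)
bdim-isBdim S = proj₂ (bdim-exists S)

------------------------------------------------------------------------
-- The lexicographic product and the BCD signature on it

lexGraph : Graph → Graph → Graph
lexGraph G H = record
  { V        = G.V × H.V
  ; size     = G.size ℕ.* H.size
  ; finite   = ↔-sym *↔× ↔-∘ (G.finite ×-↔ H.finite)
  ; _~_      = λ (u , v) (u′ , v′) → u G.~ u′ ⊎ (u ≡ u′ × v H.~ v′)
  ; _~?_     = λ (u , v) (u′ , v′) →
      (u G.~? u′) ⊎-dec ((u G.≟ u′) ×-dec (v H.~? v′))
  ; ~-sym    = λ { (inj₁ e)       → inj₁ (G.~-sym e)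
                 ; (inj₂ (p , e)) → inj₂ (sym p , H.~-sym e) }
  ; ~-irrefl = λ { (inj₁ e)       → G.~-irrefl e
                 ; (inj₂ (_ , e)) → H.~-irrefl e }
  }
  where
  module G = Graph G
  module H = Graph H

module _ (S T : SignedGraph) where
  private
    module S = SignedGraph S
    module T = SignedGraph T
    module L = Graph (lexGraph S.graph T.graph)

    nonadjacent : ∀ {u u′ v v′} → ¬ (u S.~ u′) → ¬ (v T.~ v′) →
                  ¬ ((u , v) L.~ (u′ , v′))
    nonadjacent ¬e ¬f (inj₁ e)       = ¬e e
    nonadjacent ¬e ¬f (inj₂ (_ , f)) = ¬f f

  -- On an edge of the product, ¬ (u ~ u′) forces u ≡ u′ and v ~ v′; hence the
  -- third clause is the case u ≡ u′ and the last clause is impossible.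

  bcdSign : ∀ {u u′ v v′} → Dec (u S.~ u′) → Dec (v T.~ v′) →
            .((u , v) L.~ (u′ , v′)) → Sign
  bcdSign (yes e) (no _)  _ = S.σ e
  bcdSign (yes e) (yes f) _ = S.σ e Sign.* T.σ f
  bcdSign (no _)  (yes f) _ = T.σ f
  bcdSign (no ¬e) (no ¬f) a = contradiction-irr a (nonadjacent ¬e ¬f)

  bcdSign-sym : ∀ {u u′ v v′}
    (d : Dec (u S.~ u′)) (d′ : Dec (u′ S.~ u))
    (c : Dec (v T.~ v′)) (c′ : Dec (v′ T.~ v))
    .(a : (u , v) L.~ (u′ , v′)) →
    bcdSign d′ c′ (L.~-sym a) ≡ bcdSign d c a
  bcdSign-sym (yes e) (no ¬e) _ _ _ = contradiction (S.~-sym e) ¬e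
  bcdSign-sym (no ¬e) (yes e) _ _ _ = contradiction (S.~-sym e) ¬e
  bcdSign-sym _ _ (yes f) (no ¬f) _ = contradiction (T.~-sym f) ¬f
  bcdSign-sym _ _ (no ¬f) (yes f) _ = contradiction (T.~-sym f) ¬f
  bcdSign-sym (yes e) (yes _) (no _)  (no _)  _ = S.σ-sym e
  bcdSign-sym (yes e) (yes _) (yes f) (yes _) _ =
    cong₂ Sign._*_ (S.σ-sym e) (T.σ-sym f)
  bcdSign-sym (no _)  (no _)  (yes f) (yes _) _ = T.σ-sym f
  bcdSign-sym (no ¬e) (no _)  (no ¬f) (no _)  a =
    contradiction-irr a (nonadjacent ¬e ¬f)

infixl 7 _⋆_

_⋆_ : SignedGraph → SignedGraph → SignedGraph
S ⋆ T = record
  { graph = lexGraph S.graph T.graph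
  ; σ     = λ { {u , v} {u′ , v′} a →
      bcdSign S T (u S.~? u′) (v T.~? v′) a }
  ; σ-sym = λ { {u , v} {u′ , v′} a →
      bcdSign-sym S T (u S.~? u′) (u′ S.~? u) (v T.~? v′) (v′ T.~? v) a }
  }
  where
  module S = SignedGraph S
  module T = SignedGraph T

{-# OPTIONS --safe #-}

-- The fibre {u} × V₂ may be given the single vector ζ(u): the sign of a product
-- edge over an edge of Σ₁ is that edge's sign, since Σ₂ is all-positive, and an
-- edge inside a fibre only needs ⟨ζ(u),ζ(u)⟩ > 0.  The latter holds unless
-- ζ(u) = 0, which forces u to be isolated, so that ζ(u) can be changed freely.
-- Conversely, a switching function of the product restricts to a copy of Σ₁.

module Submission where

open import Defs
open import Data.Fin using (zero; suc)
open import Data.Integer as ℤ using (+_; 0ℤ; 1ℤ; sign)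
import Data.Integer.Properties as ℤₚ
open import Algebra.Properties.Monoid.Sum ℤₚ.+-0-monoid
  using (sum-cong-≗; sum-replicate-zero)
open import Data.Nat using (zero; suc; _≤_)
open import Data.Nat.Properties using (≤-antisym)
open import Data.Product using (∃-syntax; _,_; proj₂)
open import Data.Sign as Sign using ()
import Data.Sign.Properties as Signₚ
open import Data.Sum using (inj₁; inj₂)
open import Data.Vec.Functional using (Vector)
open import Function using (_∘_)
open import Relation.Binary.PropositionalEquality
  using (_≡_; _≢_; refl; sym; trans; cong; cong₂)
open import Relation.Nullary using (yes; no; contradiction)

⟨x,x⟩-nonNegative : ∀ {k} (x : Vector Ω k) → ∃[ n ] ⟨ x , x ⟩ ≡ + n
⟨x,x⟩-nonNegative {zero}  x = 0 , refl
⟨x,x⟩-nonNegative {suc k} x with x zero | ⟨x,x⟩-nonNegative (x ∘ suc)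
... | -1Ω | n , p = suc n , cong (ℤ._+_ 1ℤ) p
... | 0Ω  | n , p = n , cong (ℤ._+_ 0ℤ) p
... | 1Ω  | n , p = suc n , cong (ℤ._+_ 1ℤ) p

sign-⟨x,x⟩ : ∀ {k} (x : Vector Ω k) → sign ⟨ x , x ⟩ ≡ Sign.+
sign-⟨x,x⟩ x = cong sign (proj₂ (⟨x,x⟩-nonNegative x))

-- An entry of absolute value 1 adds 1 to a remainder that is nonnegative, so the total could not
-- vanish.
⟨x,x⟩≡0⇒x≗0 : ∀ {k} (x : Vector Ω k) → ⟨ x , x ⟩ ≡ 0ℤ → ∀ i → x i ≡ 0Ω
⟨x,x⟩≡0⇒x≗0 {suc k} x eq i
  with x zero in x₀ | ⟨x,x⟩-nonNegative (x ∘ suc)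
... | -1Ω | n , p = contradiction (trans (cong (ℤ._+_ 1ℤ) (sym p)) eq) λ ()
... | 1Ω  | n , p = contradiction (trans (cong (ℤ._+_ 1ℤ) (sym p)) eq) λ ()
... | 0Ω  | n , p with i
...   | zero  = x₀
...   | suc j = ⟨x,x⟩≡0⇒x≗0 (x ∘ suc) (trans (sym (ℤₚ.+-identityˡ _)) eq) j

⟨x,x⟩≡0⇒⟨x,y⟩≡0 : ∀ {k} (x y : Vector Ω k) → ⟨ x , x ⟩ ≡ 0ℤ → ⟨ x , y ⟩ ≡ 0ℤ
⟨x,x⟩≡0⇒⟨x,y⟩≡0 {k} x y eq = trans
  (sum-cong-≗ λ i → cong (λ a → toℤ a ℤ.* toℤ (y i)) (⟨x,x⟩≡0⇒x≗0 x eq i))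
  (sum-replicate-zero k)

-- Nullity is tested through the squared norm, a decidable equation in the integers. The all-ones
-- vector is an arbitrary replacement with positive norm once `1 ≤ k`.
nonNull : ∀ {k} → Vector Ω k → Vector Ω k
nonNull x with ⟨ x , x ⟩ ℤ.≟ 0ℤ
... | yes _ = λ _ → 1Ω
... | no _  = x

nonNull-⟨x,x⟩≢0 : ∀ {k} → 1 ≤ k → (x : Vector Ω k) →
                  ⟨ nonNull x , nonNull x ⟩ ≢ 0ℤ
nonNull-⟨x,x⟩≢0 {suc k} _ x with ⟨ x , x ⟩ ℤ.≟ 0ℤ
-- Since `k` is positive, coordinate `zero` exists, and its entry `1Ω` would have to be `0Ω`.
... | yes _ = λ eq → contradiction (⟨x,x⟩≡0⇒x≗0 {suc k} (λ _ → 1Ω) eq zero) λ ()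
... | no ≢0 = ≢0

⟨x,y⟩≢0⇒nonNull-x≡x : ∀ {k} (x y : Vector Ω k) → ⟨ x , y ⟩ ≢ 0ℤ → nonNull x ≡ x
⟨x,y⟩≢0⇒nonNull-x≡x x y ≢0 with ⟨ x , x ⟩ ℤ.≟ 0ℤ
... | yes eq = contradiction (⟨x,x⟩≡0⇒⟨x,y⟩≡0 x y eq) ≢0
... | no _   = refl

-- Neither vector can be null, as a null one is orthogonal to everything. Hence the replacement is
-- invisible along edges of the first factor.
nonNull-preserves-⟨⟩≢0 : ∀ {k} (x y : Vector Ω k) → ⟨ x , y ⟩ ≢ 0ℤ →
                         ⟨ nonNull x , nonNull y ⟩ ≡ ⟨ x , y ⟩
nonNull-preserves-⟨⟩≢0 x y ≢0 = cong₂ ⟨_,_⟩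
  (⟨x,y⟩≢0⇒nonNull-x≡x x y ≢0)
  (⟨x,y⟩≢0⇒nonNull-x≡x y x (≢0 ∘ trans (⟨⟩-comm x y)))

module _ (S T : SignedGraph) where
  private
    module S = SignedGraph S
    module T = SignedGraph T
    module S⋆T = SignedGraph (S ⋆ T)

  -- If `v` and `v′` are adjacent, the extra factor from `T` is positive; otherwise there is none.
  -- The case `v = v′` serves the restriction to a copy of `S`.
  σ-⋆-over-edge : AllPositive T → ∀ {u u′ v v′} (e : u S.~ u′) →
                  S⋆T.σ {u , v} {u′ , v′} (inj₁ e) ≡ S.σ e
  σ-⋆-over-edge T⁺ {u} {u′} {v} {v′} e with u S.~? u′ | v T.~? v′
  ... | yes _ | no _  = refl
  ... | yes _ | yes f = trans (cong (Sign._*_ (S.σ e)) (T⁺ f)) (Signₚ.*-identityʳ _)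
  ... | no ¬e | _     = contradiction e ¬e

  σ-⋆-in-fibre : ∀ {u v v′} (f : v T.~ v′) →
                 S⋆T.σ {u , v} {u , v′} (inj₂ (refl , f)) ≡ T.σ f
  σ-⋆-in-fibre {u} {v} {v′} f with u S.~? u | v T.~? v′
  ... | yes e | _     = contradiction e S.~-irrefl
  ... | no _  | yes _ = refl
  ... | no _  | no ¬f = contradiction f ¬f

  balanceable-⋆⁺ : AllPositive T → ∀ {k} → 1 ≤ k →
                   Balanceable S k → Balanceable (S ⋆ T) k
  balanceable-⋆⁺ T⁺ {k} 1≤k (Z , pos) =
    record { ζ = ξ ; nonzero = ξ-nonzero } , ξ-positive
    where
    open SwitchingFunction Z

    ξ : S⋆T.V → Vector Ω k
    ξ (u , _) = nonNull (ζ u)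

    ξ-over-edge : ∀ {u u′} → u S.~ u′ →
                  ⟨ nonNull (ζ u) , nonNull (ζ u′) ⟩ ≡ ⟨ ζ u , ζ u′ ⟩
    ξ-over-edge {u} {u′} e = nonNull-preserves-⟨⟩≢0 (ζ u) (ζ u′) (nonzero e)

    ξ-nonzero : ∀ {p q} → p S⋆T.~ q → ⟨ ξ p , ξ q ⟩ ≢ 0ℤ
    -- Over an edge the old inner product survives; inside a fibre it is the squared norm of a
    -- vector made non-null.
    ξ-nonzero (inj₁ e)                  = nonzero e ∘ trans (sym (ξ-over-edge e))
    ξ-nonzero {u , _} (inj₂ (refl , _)) = nonNull-⟨x,x⟩≢0 1≤k (ζ u)

    ξ-positive : ∀ {p q} (a : p S⋆T.~ q) →
                 S⋆T.σ a Sign.* sign ⟨ ξ p , ξ q ⟩ ≡ Sign.+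
    ξ-positive (inj₁ e) = trans
      (cong₂ Sign._*_ (σ-⋆-over-edge T⁺ e) (cong sign (ξ-over-edge e)))
      (pos e)
    ξ-positive {u , _} (inj₂ (refl , f)) = cong₂ Sign._*_
      (trans (σ-⋆-in-fibre f) (T⁺ f))
      (sign-⟨x,x⟩ (nonNull (ζ u)))

  balanceable-⋆⁻ : AllPositive T → T.V → ∀ {k} →
                   Balanceable (S ⋆ T) k → Balanceable S k
  balanceable-⋆⁻ T⁺ v (Z , pos) =
    record { ζ = λ u → ζ (u , v) ; nonzero = nonzero ∘ inj₁ } ,
    λ {u} {u′} e → trans
      (cong (Sign._* sign ⟨ ζ (u , v) , ζ (u′ , v) ⟩) (sym (σ-⋆-over-edge T⁺ e)))
      (pos (inj₁ e))
    where open SwitchingFunction Z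

-- The minimum for `T` is attained, so it is a competitor in the minimum for `S`.
bdim-mono : ∀ S T → (∀ {k} → 1 ≤ k → Balanceable T k → Balanceable S k) →
            bdim S ≤ bdim T
bdim-mono S T T⇒S =
  let (_ , _ , least) = bdim-isBdim S ; (1≤k , balanceable , _) = bdim-isBdim T
  in least (bdim T) 1≤k (T⇒S 1≤k balanceable)

theorem2p23 : (Σ₁ Σ₂ : SignedGraph) →
    Connected (SignedGraph.graph Σ₁) → Connected (SignedGraph.graph Σ₂) →
    AllPositive Σ₂ →
    bdim (Σ₁ ⋆ Σ₂) ≡ bdim Σ₁
-- Connectedness supplies the vertex `v` at which the copy of `Σ₁` is taken.
theorem2p23 Σ₁ Σ₂ _ (v , _) Σ₂⁺ = ≤-antisym
  (bdim-mono (Σ₁ ⋆ Σ₂) Σ₁ (balanceable-⋆⁺ Σ₁ Σ₂ Σ₂⁺))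
  (bdim-mono Σ₁ (Σ₁ ⋆ Σ₂) λ _ → balanceable-⋆⁻ Σ₁ Σ₂ Σ₂⁺ v)
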